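{- Let $k\in\mathbb{Z}_+$ be a positive integer. A hypergraph $G=(V,E)$ is $k$-hyperedge-connected if and only if $G$ can be obtained by starting from the single vertex hypergraph with no hyperedges and repeatedly applying one of the following two operations: (1) add a new hyperedge over a subset of vertices of the existing hypergraph, and (2) $(k,p)$-pinching hyperedges of the existing hypergraph for some positive integer $p\le k$.
   Context: Here hypergraph means multi-hypergraph: a finite (nonempty) vertex set $V$ together with a finite multiset $E$ of hyperedges, each a subset of $V$ (parallel copies allowed and regarded as distinct hyperedges). For $X\subseteq V$, $d_G(X)$ is the number of hyperedges $e$ (with multiplicity) with $e\cap X\ne\emptyset$ and $e\setminus X\neq\emptyset$. $G$ is $k$-hyperedge-connected if $d_G(X)\ge k$ for every non-empty proper subset $X\subsetneq V$. For positive integers $p\le k$, $(k,p)$-pinching hyperedges of $G=(V,E)$ means obtaining a new hypergraph as follows: (1) pick $p$ distinct hyperedges $e_1,\dots,e_p\in E$; (2) pick positive integers $t_1,\dots,t_p$ with $\sum_{i=1}^p t_i=k$; (3) for each $i\in[p]$ choose a partition of $e_i$ into $t_i$ non-empty parts $e_i=\biguplus_{j\in[t_i]}f_i^j$; (4) remove the hyperedges $e_1,\dots,e_p$; (5) add a new vertex $s$ and the hyperedges $f_i^j\cup\{s\}$ for all $j\in[t_i]$, $i\in[p]$. -}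

module Defs where

open import Data.Fin.Base using (Fin)
open import Data.Fin.Permutation using (Permutation′; _⟨$⟩ˡ_)
open import Data.Fin.Subset
  using (Subset; inside; outside; ⊤; Nonempty; Empty; _∩_; _─_; _⊂_; ⋃)
open import Data.Fin.Subset.Properties using (nonempty?)
open import Data.List.Base using (List; []; _∷_; _++_; map; concat; tabulate; filter; length; sum)
open import Data.List.Relation.Binary.Permutation.Propositional using (_↭_)
open import Data.Nat.Base using (ℕ; suc; _≤_; NonZero)
open import Data.Product.Base using (_×_; Σ-syntax)
import Data.Vec.Base as Vec
open import Relation.Binary.PropositionalEquality.Core using (_≡_; _≢_)
open import Relation.Nullary.Decidable.Core using (Dec; _×-dec_)

-- The vertex set is Fin n.  The list of hyperedges stands for a multiset: its
-- order is immaterial, and equal entries at different positions are parallel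
-- (distinct) hyperedges.  The empty set is allowed as a hyperedge.
record Hypergraph (n : ℕ) : Set where
  constructor hypergraph
  field
    .{{nonempty}} : NonZero n
    edges : List (Subset n)

open Hypergraph public using (edges)

Crosses : ∀ {n} → Subset n → Subset n → Set
Crosses X e = Nonempty (e ∩ X) × Nonempty (e ─ X)

crosses? : ∀ {n} (X e : Subset n) → Dec (Crosses X e)
crosses? X e = nonempty? (e ∩ X) ×-dec nonempty? (e ─ X)

d : ∀ {n} → Hypergraph n → Subset n → ℕ
d G X = length (filter (crosses? X) (edges G))

_HyperedgeConnected_ : ∀ {n} → ℕ → Hypergraph n → Set
k HyperedgeConnected G = ∀ X → Nonempty X → X ⊂ ⊤ → k ≤ d G X

image : ∀ {n} → Permutation′ n → Subset n → Subset n
image π X = Vec.tabulate λ v → Vec.lookup X (π ⟨$⟩ˡ v)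

_≅_ : ∀ {n} → Hypergraph n → Hypergraph n → Set
_≅_ {n} G H = Σ[ π ∈ Permutation′ n ] map (image π) (edges G) ↭ edges H

record IsPartition {n t : ℕ} (e : Subset n) (f : Fin t → Subset n) : Set where
  field
    nonempty : ∀ j → Nonempty (f j)
    disjoint : ∀ {j j′} → j ≢ j′ → Empty (f j ∩ f j′)
    covers   : ⋃ (tabulate f) ≡ e

record Pinching {n : ℕ} (k p : ℕ) (G : Hypergraph n) : Set where
  field
    -- Choosing p distinct members of a multiset is splitting it as p members
    -- together with the remaining ones; parallel hyperedges may both be chosen.
    e     : Fin p → Subset n
    rest  : List (Subset n)
    split : edges G ↭ tabulate e ++ rest

    t          : Fin p → ℕ
    t-positive : ∀ i → 1 ≤ t i
    t-sum      : sum (tabulate t) ≡ k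

    f           : ∀ i → Fin (t i) → Subset n
    f-partition : ∀ i → IsPartition (e i) (f i)

-- The new vertex s is the vertex zero of Fin (suc n), and each old vertex v
-- becomes suc v.  Thus outside ∷ X is X itself and inside ∷ X is X ∪ {s}.
pinched : ∀ {n k p} {G : Hypergraph n} → Pinching k p G → Hypergraph (suc n)
pinched P = hypergraph
  (map (outside Vec.∷_) rest
    ++ concat (tabulate λ i → tabulate λ j → inside Vec.∷ f i j))
  where open Pinching P

-- With Fin n as vertex set, the names of the starting vertex and of each new
-- vertex are forced, as is the order of the hyperedges; the constructor relabel
-- makes both arbitrary.
data Obtainable (k : ℕ) : ∀ {n} → Hypergraph n → Set where
  single  : Obtainable k {1} (hypergraph [])
  add     : ∀ {n} {G : Hypergraph n} → Obtainable k G → (e : Subset n) →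
            Obtainable k (record G { edges = e ∷ edges G })
  pinch   : ∀ {n p} {G : Hypergraph n} → Obtainable k G → 1 ≤ p → p ≤ k →
            (P : Pinching k p G) → Obtainable k (pinched P)
  relabel : ∀ {n} {G H : Hypergraph n} → Obtainable k G → G ≅ H → Obtainable k H

{-# OPTIONS --safe #-}
module Submission where

-- Connected ⇒ obtainable.  Delete hyperedges as long as the hypergraph stays
-- k-connected.  Then every hyperedge crosses a tight set (one with a cut of
-- exactly k).  By submodularity no hyperedge lies inside an inclusion-minimal
-- tight set X, so every hyperedge at a vertex v of X leaves X, and v has degree
-- exactly k.  Undo a pinching at v by handling the hyperedges e ∪ {v} one by one:
-- if no tight set contains e, remove v from the hyperedge.  Otherwise take a
-- maximal tight X ⊇ e; some hyperedge f ∪ {v} has f disjoint from X, since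
-- otherwise the complement of X would have a cut below k, and e ∪ {v}, f ∪ {v}
-- can be merged into e ∪ f ∪ {v}: a tight Y meeting both e and f would have a
-- tight union with X, against maximality, or cover all vertices together with X,
-- which is impossible by counting the cuts of the two complements.
--
-- Obtainable ⇒ connected.  A cut crossed by e is crossed by some f ∪ {s} with f
-- a part of e, and s itself has degree k.

open import Data.Bool.Base using (if_then_else_; true; false)
open import Data.Empty using (⊥-elim)
open import Data.Fin.Base using (Fin; zero; suc)
open import Data.Fin.Permutation using (Permutation′; _⟨$⟩ˡ_; _⟨$⟩ʳ_; inverseˡ; inverseʳ; flip; transpose)
  renaming (id to idₚ)
open import Data.Fin.Properties using (_≟_)
open import Data.Fin.Subset
open import Data.Fin.Subset.Induction using (⊂-wellFounded; ⊃-wellFounded)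
open import Data.Fin.Subset.Properties
open import Data.List.Base using (List; []; _∷_; [_]; _++_; concat; filter; length; lookup; map; tabulate)
open import Data.List.Membership.Propositional using (find; lose) renaming (_∈_ to _∈ˡ_)
open import Data.List.Membership.Propositional.Properties using (∈-lookup; ∈-∃++)
open import Data.List.Properties
open import Data.List.Relation.Binary.Permutation.Propositional as ↭
  using (_↭_; ↭-refl; ↭-sym; ↭-trans; ↭-reflexive; module PermutationReasoning)
open import Data.List.Relation.Binary.Permutation.Propositional.Properties
  using (All-resp-↭; ++-comm; ++⁺ˡ; ++⁺ʳ; filter-↭; map⁺; shift; shifts; ↭-length; ↭-map-inv)
open import Data.List.Relation.Unary.All as All using (All; []; _∷_)
import Data.List.Relation.Unary.All.Properties as All
open import Data.List.Relation.Unary.AllPairs as AllPairs using (AllPairs; []; _∷_)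
import Data.List.Relation.Unary.AllPairs.Properties as AllPairs
open import Data.List.Relation.Unary.Any using (Any; any?; here; there)
import Data.List.Relation.Unary.Any.Properties as Any
open import Data.Nat.Base using (ℕ; NonZero; ≢-nonZero⁻¹; >-nonZero⁻¹; zero; suc; _+_; _≤_; _<_; z≤n; s≤s)
open import Data.Nat.ListAction using (sum)
open import Data.Nat.Properties as ℕ hiding (_≟_)
open import Data.Product.Base using (_×_; _,_; proj₁; proj₂; ∃; ∃₂)
open import Data.Sum.Base using (_⊎_; inj₁; inj₂; [_,_]′)
open import Data.Vec.Base as Vec using (_∷_)
import Data.Vec.Properties as Vec
open import Algebra.Properties.CommutativeSemigroup +-commutativeSemigroup
  using (interchange; x∙yz≈y∙xz)
open import Function.Base using (_∘_; id)
open import Function.Bundles using (_⇔_; mk⇔)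
open import Induction.WellFounded using (Acc; acc)
open import Level using (Level)
open import Relation.Binary.Core using (Rel)
open import Relation.Binary.PropositionalEquality
  using (_≡_; _≢_; refl; sym; trans; cong; cong₂; subst; module ≡-Reasoning)
open import Relation.Nullary using (Dec; yes; no; ¬_; does; contradiction; ¬?; _×-dec_)
open import Relation.Nullary.Decidable using (dec-true; decidable-stable)
open import Relation.Unary using (Pred; Decidable)
open import Defs

private
  variable
    a b p q p₁ p₂ q₁ q₂ : Level
    A : Set a
    n : ℕ

-- Indicators and counting in lists.

ι : {P : Set p} → Dec P → ℕ
ι P? = if does P? then 1 else 0

ι-yes : {P : Set p} (P? : Dec P) → P → ι P? ≡ 1
ι-yes (yes _) _ = refl
ι-yes (no ¬p) p = contradiction p ¬p

ι-no : {P : Set p} (P? : Dec P) → ¬ P → ι P? ≡ 0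
ι-no (yes p) ¬p = contradiction p ¬p
ι-no (no _)  _  = refl

ι≤1 : {P : Set p} (P? : Dec P) → ι P? ≤ 1
ι≤1 (yes _) = ≤-refl
ι≤1 (no _)  = z≤n

ι-mono : {P : Set p} {Q : Set q} (P? : Dec P) (Q? : Dec Q) → (P → Q) → ι P? ≤ ι Q?
ι-mono (yes p) Q? f = ≤-reflexive (sym (ι-yes Q? (f p)))
ι-mono (no _)  _  _ = z≤n

-- Supplies the contribution of a single hyperedge to the submodular inequalities: there `P₁` and
-- `P₂` concern the intersection and the union, `Q₁` and `Q₂` the two sets themselves.
ι-exchange : {P₁ : Set p₁} {P₂ : Set p₂} {Q₁ : Set q₁} {Q₂ : Set q₂}
  (P₁? : Dec P₁) (P₂? : Dec P₂) (Q₁? : Dec Q₁) (Q₂? : Dec Q₂) →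
  (P₁ → Q₁ ⊎ Q₂) → (P₂ → Q₁ ⊎ Q₂) → (P₁ → P₂ → Q₁ × Q₂) →
  ι P₁? + ι P₂? ≤ ι Q₁? + ι Q₂?
ι-exchange (yes x) (yes y) Q₁? Q₂? f g h
  rewrite ι-yes Q₁? (proj₁ (h x y)) | ι-yes Q₂? (proj₂ (h x y)) = ≤-refl
ι-exchange (yes x) (no _) Q₁? Q₂? f g h with f x
... | inj₁ q rewrite ι-yes Q₁? q = s≤s z≤n
... | inj₂ q rewrite ι-yes Q₂? q = m≤n+m 1 (ι Q₁?)
ι-exchange (no _) (yes y) Q₁? Q₂? f g h with g y
... | inj₁ q rewrite ι-yes Q₁? q = s≤s z≤n
... | inj₂ q rewrite ι-yes Q₂? q = m≤n+m 1 (ι Q₁?)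
ι-exchange (no _) (no _) _ _ _ _ _ = z≤n

count : {P : Pred A p} → Decidable P → List A → ℕ
count P? xs = length (filter P? xs)

module _ {P : Pred A p} (P? : Decidable P) where

  count-∷ : ∀ x xs → count P? (x ∷ xs) ≡ ι (P? x) + count P? xs
  count-∷ x xs with does (P? x)
  ... | true  = refl
  ... | false = refl

  count-++ : ∀ xs ys → count P? (xs ++ ys) ≡ count P? xs + count P? ys
  count-++ xs ys = trans (cong length (filter-++ P? xs ys)) (length-++ (filter P? xs))

  count-↭ : ∀ {xs ys} → xs ↭ ys → count P? xs ≡ count P? ys
  count-↭ = ↭-length ∘ filter-↭ P?

count-mono : {P : Pred A p} {Q : Pred A q} (P? : Decidable P) (Q? : Decidable Q) {xs : List A} →
  All (λ x → P x → Q x) xs → count P? xs ≤ count Q? xs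
count-mono P? Q? [] = z≤n
count-mono P? Q? {x ∷ xs} (f ∷ fs) rewrite count-∷ P? x xs | count-∷ Q? x xs =
  +-mono-≤ (ι-mono (P? x) (Q? x) f) (count-mono P? Q? fs)

count-cong : {P : Pred A p} {Q : Pred A q} (P? : Decidable P) (Q? : Decidable Q) →
  (∀ x → P x → Q x) → (∀ x → Q x → P x) → ∀ xs → count P? xs ≡ count Q? xs
count-cong P? Q? f g xs = ≤-antisym
  (count-mono P? Q? (All.universal f xs)) (count-mono Q? P? (All.universal g xs))

count-map : {B : Set b} {P : Pred B p} (P? : Decidable P) (h : A → B) → ∀ xs →
  count P? (map h xs) ≡ count (P? ∘ h) xs
count-map P? h []       = refl
count-map P? h (x ∷ xs) = begin
  count P? (h x ∷ map h xs)          ≡⟨ count-∷ P? (h x) (map h xs) ⟩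
  ι (P? (h x)) + count P? (map h xs) ≡⟨ cong (ι (P? (h x)) +_) (count-map P? h xs) ⟩
  ι (P? (h x)) + count (P? ∘ h) xs   ≡⟨ count-∷ (P? ∘ h) x xs ⟨
  count (P? ∘ h) (x ∷ xs)            ∎
  where open ≡-Reasoning

count-exchange : {P₁ : Pred A p₁} {P₂ : Pred A p₂} {Q₁ : Pred A q₁} {Q₂ : Pred A q₂}
  (P₁? : Decidable P₁) (P₂? : Decidable P₂) (Q₁? : Decidable Q₁) (Q₂? : Decidable Q₂) →
  (∀ x → P₁ x → Q₁ x ⊎ Q₂ x) → (∀ x → P₂ x → Q₁ x ⊎ Q₂ x) → (∀ x → P₁ x → P₂ x → Q₁ x × Q₂ x) →
  ∀ xs → count P₁? xs + count P₂? xs ≤ count Q₁? xs + count Q₂? xs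
count-exchange P₁? P₂? Q₁? Q₂? f g h [] = z≤n
count-exchange P₁? P₂? Q₁? Q₂? f g h (x ∷ xs)
  rewrite count-∷ P₁? x xs | count-∷ P₂? x xs | count-∷ Q₁? x xs | count-∷ Q₂? x xs
        | interchange (ι (P₁? x)) (count P₁? xs) (ι (P₂? x)) (count P₂? xs)
        | interchange (ι (Q₁? x)) (count Q₁? xs) (ι (Q₂? x)) (count Q₂? xs) =
  +-mono-≤ (ι-exchange (P₁? x) (P₂? x) (Q₁? x) (Q₂? x) (f x) (g x) (h x))
           (count-exchange P₁? P₂? Q₁? Q₂? f g h xs)

∈⇒↭∷ : ∀ {x : A} {xs} → x ∈ˡ xs → ∃ λ ys → xs ↭ x ∷ ys
∈⇒↭∷ x∈xs with ∈-∃++ x∈xs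
... | ys , zs , refl = ys ++ zs , shift _ ys zs

-- Subsets, and hyperedges meeting or crossing them.

maximal : {P : Pred (Subset n) p} → Decidable P → ∃ P →
  ∃ λ X → P X × (∀ Y → X ⊂ Y → ¬ P Y)
maximal {n = n} {P = P} P? (X₀ , PX₀) = go X₀ PX₀ (⊃-wellFounded X₀)
  where
  go : ∀ X → P X → Acc _⊃_ X → ∃ λ X → P X × (∀ Y → X ⊂ Y → ¬ P Y)
  go X PX (acc rec) with anySubset? (λ Y → (X ⊂? Y) ×-dec P? Y)
  ... | yes (Y , X⊂Y , PY) = go Y PY (rec X⊂Y)
  ... | no  ∄Y             = X , PX , λ Y X⊂Y PY → ∄Y (Y , X⊂Y , PY)

x∈p─q⇒x∉q : ∀ {x} (p q : Subset n) → x ∈ p ─ q → x ∉ q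
x∈p─q⇒x∉q (inside ∷ p) (inside ∷ q) () Vec.here
x∈p─q⇒x∉q (outside ∷ p) (inside ∷ q) () Vec.here
x∈p─q⇒x∉q (_ ∷ p) (_ ∷ q) (Vec.there x∈p─q) (Vec.there x∈q) = x∈p─q⇒x∉q p q x∈p─q x∈q

Empty─⇒⊆ : ∀ {p q : Subset n} → Empty (p ─ q) → p ⊆ q
Empty─⇒⊆ {q = q} p─q≡∅ {x} x∈p with x ∈? q
... | yes x∈q = x∈q
... | no  x∉q = ⊥-elim (p─q≡∅ (x , x∈p∧x∉q⇒x∈p─q x∈p x∉q))

∉⇒⊂⊤ : ∀ {x} {p : Subset n} → x ∉ p → p ⊂ ⊤
∉⇒⊂⊤ {x = x} x∉p = ⊆⊤ , x , ∈⊤ , x∉p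

Meets : Subset n → Subset n → Set
Meets X e = Nonempty (e ∩ X)

meets? : (X e : Subset n) → Dec (Meets X e)
meets? X e = nonempty? (e ∩ X)

meets⁺ : ∀ {x} {X e : Subset n} → x ∈ e → x ∈ X → Meets X e
meets⁺ x∈e x∈X = _ , x∈p∩q⁺ (x∈e , x∈X)

meets⁻ : (X e : Subset n) → Meets X e → ∃ λ x → x ∈ e × x ∈ X
meets⁻ X e (x , x∈e∩X) = x , x∈p∩q⁻ e X x∈e∩X

crosses⁺ : ∀ {x y} {X e : Subset n} → x ∈ e → x ∈ X → y ∈ e → y ∉ X → Crosses X e
crosses⁺ x∈e x∈X y∈e y∉X = meets⁺ x∈e x∈X , _ , x∈p∧x∉q⇒x∈p─q y∈e y∉X

crosses⁻ : (X e : Subset n) → Crosses X e →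
  (∃ λ x → x ∈ e × x ∈ X) × (∃ λ y → y ∈ e × y ∉ X)
crosses⁻ X e (m , y , y∈e─X) = meets⁻ X e m , y , p─q⊆p e X y∈e─X , x∈p─q⇒x∉q e X y∈e─X

crosses-∁ : ∀ {X e : Subset n} → Crosses X e → Crosses (∁ X) e
crosses-∁ {X = X} {e} c =
  let (x , x∈e , x∈X) , (y , y∈e , y∉X) = crosses⁻ X e c
  in crosses⁺ y∈e (x∉p⇒x∈∁p y∉X) x∈e (x∈p⇒x∉∁p x∈X)

crosses-∁⁻ : ∀ {X e : Subset n} → Crosses (∁ X) e → Crosses X e
crosses-∁⁻ {X = X} {e} c =
  let (x , x∈e , x∈∁X) , (y , y∈e , y∉∁X) = crosses⁻ (∁ X) e c
  in crosses⁺ y∈e (x∉∁p⇒x∈p y∉∁X) x∈e (x∈∁p⇒x∉p x∈∁X)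

-- Cuts and submodularity.

cut : List (Subset n) → Subset n → ℕ
cut es X = count (crosses? X) es

cut-∁ : ∀ (es : List (Subset n)) X → cut es (∁ X) ≡ cut es X
cut-∁ es X = count-cong (crosses? (∁ X)) (crosses? X) (λ _ → crosses-∁⁻) (λ _ → crosses-∁) es

meets-submodular : ∀ (es : List (Subset n)) X Y →
  count (meets? (X ∩ Y)) es + count (meets? (X ∪ Y)) es ≤ count (meets? X) es + count (meets? Y) es
meets-submodular es X Y = count-exchange (meets? (X ∩ Y)) (meets? (X ∪ Y)) (meets? X) (meets? Y)
  (λ e m → inj₁ (proj₁ (both e m)))
  (λ e m → let x , x∈e , x∈∪ = meets⁻ (X ∪ Y) e m in
    [ inj₁ ∘ meets⁺ x∈e , inj₂ ∘ meets⁺ x∈e ]′ (x∈p∪q⁻ X Y x∈∪))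
  (λ e m _ → both e m)
  es
  where
  both : ∀ e → Meets (X ∩ Y) e → Meets X e × Meets Y e
  both e m = let x , x∈e , x∈∩ = meets⁻ (X ∩ Y) e m ; x∈X , x∈Y = x∈p∩q⁻ X Y x∈∩
             in meets⁺ x∈e x∈X , meets⁺ x∈e x∈Y

-- Checked hyperedge by hyperedge: one that crosses both `X ∩ Y` and `X ∪ Y` has a vertex in both
-- sets and a vertex in neither, so it crosses `X` and `Y`.
cut-submodular : ∀ (es : List (Subset n)) X Y →
  cut es (X ∩ Y) + cut es (X ∪ Y) ≤ cut es X + cut es Y
cut-submodular es X Y = count-exchange (crosses? (X ∩ Y)) (crosses? (X ∪ Y)) (crosses? X) (crosses? Y)
  only∩ only∪ both es
  where
  only∩ : ∀ e → Crosses (X ∩ Y) e → Crosses X e ⊎ Crosses Y e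
  only∩ e c with crosses⁻ (X ∩ Y) e c
  -- The endpoint `y` misses at least one of `X` and `Y`, and that set is crossed because `x` lies
  -- in both.
  ... | (x , x∈e , x∈∩) , (y , y∈e , y∉∩) with x∈p∩q⁻ X Y x∈∩ | y ∈? X
  ...   | x∈X , x∈Y | no  y∉X = inj₁ (crosses⁺ x∈e x∈X y∈e y∉X)
  ...   | x∈X , x∈Y | yes y∈X = inj₂ (crosses⁺ x∈e x∈Y y∈e (λ y∈Y → y∉∩ (x∈p∩q⁺ (y∈X , y∈Y))))
  only∪ : ∀ e → Crosses (X ∪ Y) e → Crosses X e ⊎ Crosses Y e
  only∪ e c with crosses⁻ (X ∪ Y) e c
  ... | (x , x∈e , x∈∪) , (y , y∈e , y∉∪) with x∈p∪q⁻ X Y x∈∪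
  ...   | inj₁ x∈X = inj₁ (crosses⁺ x∈e x∈X y∈e (y∉∪ ∘ x∈p∪q⁺ ∘ inj₁))
  ...   | inj₂ x∈Y = inj₂ (crosses⁺ x∈e x∈Y y∈e (y∉∪ ∘ x∈p∪q⁺ ∘ inj₂))
  both : ∀ e → Crosses (X ∩ Y) e → Crosses (X ∪ Y) e → Crosses X e × Crosses Y e
  both e c c′ =
    let (x , x∈e , x∈∩) , _ = crosses⁻ (X ∩ Y) e c
        _ , (y , y∈e , y∉∪) = crosses⁻ (X ∪ Y) e c′
        x∈X , x∈Y = x∈p∩q⁻ X Y x∈∩
    in crosses⁺ x∈e x∈X y∈e (y∉∪ ∘ x∈p∪q⁺ ∘ inj₁) , crosses⁺ x∈e x∈Y y∈e (y∉∪ ∘ x∈p∪q⁺ ∘ inj₂)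

-- Loads, tight sets and the splitting-off step.

load : List (Subset n) → List (Subset n) → Subset n → ℕ
load A B X = count (meets? X) A + cut B X

load-∷ˡ : ∀ (e : Subset n) A B X → load (e ∷ A) B X ≡ ι (meets? X e) + load A B X
load-∷ˡ e A B X = trans (cong (_+ cut B X) (count-∷ (meets? X) e A)) (+-assoc (ι (meets? X e)) _ _)

load-∷ʳ : ∀ (e : Subset n) A B X → load A (e ∷ B) X ≡ ι (crosses? X e) + load A B X
load-∷ʳ e A B X = trans (cong (count (meets? X) A +_) (count-∷ (crosses? X) e B))
  (x∙yz≈y∙xz (count (meets? X) A) (ι (crosses? X e)) (cut B X))

load-↭ : ∀ {A A′ B B′ : List (Subset n)} → A ↭ A′ → B ↭ B′ → ∀ X → load A B X ≡ load A′ B′ X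
load-↭ A↭A′ B↭B′ X = cong₂ _+_ (count-↭ (meets? X) A↭A′) (count-↭ (crosses? X) B↭B′)

load-submodular : ∀ (A B : List (Subset n)) X Y →
  load A B (X ∩ Y) + load A B (X ∪ Y) ≤ load A B X + load A B Y
load-submodular A B X Y
  rewrite interchange (count (meets? (X ∩ Y)) A) (cut B (X ∩ Y)) (count (meets? (X ∪ Y)) A) (cut B (X ∪ Y))
        | interchange (count (meets? X) A) (cut B X) (count (meets? Y) A) (cut B Y) =
  +-mono-≤ (meets-submodular A X Y) (cut-submodular B X Y)

-- For a vertex s outside Fin n and the edges {a ∪ {s} | a ∈ A} ∪ B, this is the
-- requirement that every cut other than that of s itself has at least k edges.
SplitConnected : ℕ → List (Subset n) → List (Subset n) → Set
SplitConnected k A B = ∀ X → Nonempty X → X ⊂ ⊤ → k ≤ load A B X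

Tight : ℕ → List (Subset n) → List (Subset n) → Subset n → Set
Tight k A B X = Nonempty X × X ⊂ ⊤ × load A B X ≡ k

tight? : ∀ k (A B : List (Subset n)) → Decidable (Tight k A B)
tight? k A B X = nonempty? X ×-dec ((X ⊂? ⊤) ×-dec (load A B X ℕ.≟ k))

-- Uncrossing: both loads are at least `k`, and by submodularity they sum to at most `k + k`, so
-- neither can exceed `k`.
tight-∩-∪ : ∀ {k} (A B : List (Subset n)) {X Y} → SplitConnected k A B →
  Tight k A B X → Tight k A B Y → Meets X Y → X ∪ Y ⊂ ⊤ → Tight k A B (X ∩ Y) × Tight k A B (X ∪ Y)
tight-∩-∪ {k = k} A B {X} {Y} conn (neX , X⊂⊤ , tX) (neY , Y⊂⊤ , tY) m X∪Y⊂⊤ =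
  (ne∩ , ∩⊂⊤ , ≤-antisym (+-cancelʳ-≤ k _ k (≤-trans (+-monoʳ-≤ (load A B (X ∩ Y)) k≤∪) sum≤)) k≤∩) ,
  (ne∪ , X∪Y⊂⊤ , ≤-antisym (+-cancelˡ-≤ k _ k (≤-trans (+-monoˡ-≤ (load A B (X ∪ Y)) k≤∩) sum≤)) k≤∪)
  where
  ne∩ : Nonempty (X ∩ Y)
  ne∩ = let x , x∈Y , x∈X = meets⁻ X Y m in x , x∈p∩q⁺ (x∈X , x∈Y)
  ne∪ : Nonempty (X ∪ Y)
  ne∪ = proj₁ neX , p⊆p∪q Y (proj₂ neX)
  ∩⊂⊤ : X ∩ Y ⊂ ⊤
  ∩⊂⊤ = ⊆-⊂-trans (p∩q⊆p X Y) X⊂⊤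
  k≤∩ = conn (X ∩ Y) ne∩ ∩⊂⊤
  k≤∪ = conn (X ∪ Y) ne∪ X∪Y⊂⊤
  sum≤ : load A B (X ∩ Y) + load A B (X ∪ Y) ≤ k + k
  sum≤ = ≤-trans (load-submodular A B X Y) (≤-reflexive (cong₂ _+_ tX tY))

-- The first alternative removes `s` from `e ∪ {s}`, the second merges it with a hyperedge
-- `f ∪ {s}`. Either way one hyperedge fewer remains at `s`.
split-step : ∀ {k} {e : Subset n} {A B} → Nonempty e → SplitConnected k (e ∷ A) B →
  SplitConnected k A (e ∷ B) ⊎
  (∃₂ λ f A′ → A ↭ f ∷ A′ × Empty (e ∩ f) × SplitConnected k (e ∪ f ∷ A′) B)
split-step {n = n} {k} {e} {A} {B} (x₀ , x₀∈e) conn with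
  anySubset? (λ X → tight? k (e ∷ A) B X ×-dec (e ⊆? X))
... | no ∄tight = inj₁ trim
  where
  open ≤-Reasoning
  ι≤ : ∀ X → Nonempty (e ─ X) → ι (meets? X e) ≤ ι (crosses? X e)
  ι≤ X e─X = ι-mono (meets? X e) (crosses? X e) (_, e─X)
  trim : SplitConnected k A (e ∷ B)
  trim X neX X⊂⊤ = bound (nonempty? (e ─ X))
    where
    bound : Dec (Nonempty (e ─ X)) → k ≤ load A (e ∷ B) X
    -- If `e` leaves `X`, trimming costs nothing: `e` crosses `X` whenever it meets `X`.
    bound (yes e─X) = begin
      k                             ≤⟨ conn X neX X⊂⊤ ⟩
      load (e ∷ A) B X              ≡⟨ load-∷ˡ e A B X ⟩
      ι (meets? X e) + load A B X   ≤⟨ +-monoˡ-≤ (load A B X) (ι≤ X e─X) ⟩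
      ι (crosses? X e) + load A B X ≡⟨ load-∷ʳ e A B X ⟨
      load A (e ∷ B) X              ∎
    -- If `e` lies inside `X`, trimming costs at most one unit. It is to spare, since no tight set
    -- contains `e`.
    bound (no e─X≡∅) = ≤-pred (begin-strict
      k                                 <⟨ ≤∧≢⇒< (conn X neX X⊂⊤)
                                             (λ k≡load → ∄tight (X , (neX , X⊂⊤ , sym k≡load) , Empty─⇒⊆ e─X≡∅)) ⟩
      load (e ∷ A) B X                  ≡⟨ load-∷ˡ e A B X ⟩
      ι (meets? X e) + load A B X       ≤⟨ +-mono-≤ (ι≤1 (meets? X e)) (m≤n+m (load A B X) (ι (crosses? X e))) ⟩
      1 + (ι (crosses? X e) + load A B X) ≡⟨ cong suc (load-∷ʳ e A B X) ⟨
      1 + load A (e ∷ B) X              ∎)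
... | yes ∃tight with maximal (λ X → tight? k (e ∷ A) B X ×-dec (e ⊆? X)) ∃tight
...   | X , (tX@(neX , X⊂⊤@(_ , z , _ , z∉X) , loadX) , e⊆X) , maxX with any? (λ f → ¬? (meets? X f)) A
...     | no ∄f = contradiction (conn (∁ X) (z , x∉p⇒x∈∁p z∉X) (∉⇒⊂⊤ x₀∉∁X)) (<⇒≱ load∁<k)
  where
  open ≤-Reasoning
  x₀∉∁X : x₀ ∉ ∁ X
  x₀∉∁X = x∈p⇒x∉∁p (e⊆X x₀∈e)
  e-misses-∁X : ¬ Meets (∁ X) e
  e-misses-∁X m = let y , y∈e , y∈∁X = meets⁻ (∁ X) e m in x∈∁p⇒x∉p y∈∁X (e⊆X y∈e)
  allMeet : All (Meets X) A
  allMeet = All.map (λ {f} ¬¬m → decidable-stable (meets? X f) ¬¬m) (All.¬Any⇒All¬ A ∄f)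
  -- Since every hyperedge of `A` meets `X`, replacing `X` by `∁ X` cannot raise the share of `A`,
  -- leaves the share of `B` unchanged and drops the unit contributed by `e`.
  load∁<k : load (e ∷ A) B (∁ X) < k
  load∁<k = begin-strict
    load (e ∷ A) B (∁ X)                         ≡⟨ load-∷ˡ e A B (∁ X) ⟩
    ι (meets? (∁ X) e) + load A B (∁ X)          ≡⟨ cong (_+ load A B (∁ X)) (ι-no (meets? (∁ X) e) e-misses-∁X) ⟩
    count (meets? (∁ X)) A + cut B (∁ X)         ≤⟨ +-mono-≤
                                                      (count-mono (meets? (∁ X)) (meets? X) (All.map (λ m _ → m) allMeet))
                                                      (≤-reflexive (cut-∁ B X)) ⟩
    load A B X                                   <⟨ n<1+n _ ⟩
    1 + load A B X                               ≡⟨ cong (_+ load A B X) (ι-yes (meets? X e) (meets⁺ x₀∈e (e⊆X x₀∈e))) ⟨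
    ι (meets? X e) + load A B X                  ≡⟨ load-∷ˡ e A B X ⟨
    load (e ∷ A) B X                             ≡⟨ loadX ⟩
    k                                            ∎
...     | yes ∃f with find ∃f
...       | f , f∈A , f∌X with ∈⇒↭∷ f∈A
...         | A′ , A↭ = inj₂ (f , A′ , A↭ , e∩f≡∅ , merge)
  where
  open ≤-Reasoning
  e∩f≡∅ : Empty (e ∩ f)
  e∩f≡∅ (y , y∈e∩f) = let y∈e , y∈f = x∈p∩q⁻ e f y∈e∩f in f∌X (meets⁺ y∈f (e⊆X y∈e))

  load≡ : ∀ Y → load (e ∷ A) B Y ≡ ι (meets? Y e) + (ι (meets? Y f) + load A′ B Y)
  load≡ Y = trans (load-∷ˡ e A B Y)
    (cong (ι (meets? Y e) +_) (trans (load-↭ A↭ (↭-refl {x = B}) Y) (load-∷ˡ f A′ B Y)))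

  ι-∪ : ∀ Y → ¬ (Meets Y e × Meets Y f) → ι (meets? Y e) + ι (meets? Y f) ≤ ι (meets? Y (e ∪ f))
  -- The second target of the exchange is padded with a decision of the empty type, whose indicator
  -- is 0.
  ι-∪ Y ¬both = subst (ι (meets? Y e) + ι (meets? Y f) ≤_) (+-identityʳ (ι (meets? Y (e ∪ f)))) (ι-exchange (meets? Y e) (meets? Y f) (meets? Y (e ∪ f)) (no λ b → b)
    (λ m → let y , y∈e , y∈Y = meets⁻ Y e m in inj₁ (meets⁺ (p⊆p∪q f y∈e) y∈Y))
    (λ m → let y , y∈f , y∈Y = meets⁻ Y f m in inj₁ (meets⁺ (q⊆p∪q e f y∈f) y∈Y))
    (λ m m′ → contradiction (m , m′) ¬both))

  -- If X ∪ Y were ⊤, the loads of ∁ X ⊆ Y and ∁ Y ⊆ X would add up to less than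
  -- those of X and Y, i.e. than 2k: an edge of A meeting ∁ X meets Y and vice
  -- versa, cuts are symmetric, and e meets both X and Y but not ∁ X.
  tight∪⊂⊤ : ∀ {Y} → Tight k (e ∷ A) B Y → Meets Y e → X ∪ Y ⊂ ⊤
  tight∪⊂⊤ {Y} (neY , (_ , w , _ , w∉Y) , loadY) mYe with nonempty? (∁ (X ∪ Y))
  ... | yes (v , v∈∁) = ∉⇒⊂⊤ (x∈∁p⇒x∉p v∈∁)
  ... | no  ∁≡∅ = contradiction (+-mono-≤ k≤∁X k≤∁Y) (<⇒≱ sum<)
    where
    cover : ∀ {v} → v ∉ X → v ∈ Y
    cover {v} v∉X with x∈p∪q⁻ X Y (x∉∁p⇒x∈p {p = X ∪ Y} (λ v∈∁ → ∁≡∅ (v , v∈∁)))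
    ... | inj₁ v∈X = contradiction v∈X v∉X
    ... | inj₂ v∈Y = v∈Y
    cover′ : ∀ {v} → v ∉ Y → v ∈ X
    cover′ {v} v∉Y with v ∈? X
    ... | yes v∈X = v∈X
    ... | no  v∉X = contradiction (cover v∉X) v∉Y
    k≤∁X = conn (∁ X) (z , x∉p⇒x∈∁p z∉X) (∉⇒⊂⊤ (x∈p⇒x∉∁p (proj₂ neX)))
    k≤∁Y = conn (∁ Y) (w , x∉p⇒x∈∁p w∉Y) (∉⇒⊂⊤ (x∈p⇒x∉∁p (proj₂ neY)))
    ∁X≤ : load (e ∷ A) B (∁ X) ≤ count (meets? Y) A + cut B X
    ∁X≤ = begin
      load (e ∷ A) B (∁ X)                 ≡⟨ load-∷ˡ e A B (∁ X) ⟩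
      ι (meets? (∁ X) e) + load A B (∁ X)  ≡⟨ cong (_+ load A B (∁ X)) (ι-no (meets? (∁ X) e) λ m →
                                                let y , y∈e , y∈∁X = meets⁻ (∁ X) e m in x∈∁p⇒x∉p y∈∁X (e⊆X y∈e)) ⟩
      load A B (∁ X)                       ≤⟨ +-mono-≤
                                                (count-mono (meets? (∁ X)) (meets? Y) (All.universal (λ a m →
                                                  let y , y∈a , y∈∁X = meets⁻ (∁ X) a m in meets⁺ y∈a (cover (x∈∁p⇒x∉p y∈∁X))) A))
                                                (≤-reflexive (cut-∁ B X)) ⟩
      count (meets? Y) A + cut B X         ∎
    ∁Y≤ : load (e ∷ A) B (∁ Y) ≤ 1 + (count (meets? X) A + cut B Y)
    ∁Y≤ = begin
      load (e ∷ A) B (∁ Y)                 ≡⟨ load-∷ˡ e A B (∁ Y) ⟩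
      ι (meets? (∁ Y) e) + load A B (∁ Y)  ≤⟨ +-mono-≤ (ι≤1 (meets? (∁ Y) e)) (+-mono-≤
                                                (count-mono (meets? (∁ Y)) (meets? X) (All.universal (λ a m →
                                                  let y , y∈a , y∈∁Y = meets⁻ (∁ Y) a m in meets⁺ y∈a (cover′ (x∈∁p⇒x∉p y∈∁Y))) A))
                                                (≤-reflexive (cut-∁ B Y))) ⟩
      1 + (count (meets? X) A + cut B Y)   ∎
    1+load : ∀ {Z} → Meets Z e → load (e ∷ A) B Z ≡ 1 + load A B Z
    1+load {Z} m = trans (load-∷ˡ e A B Z) (cong (_+ load A B Z) (ι-yes (meets? Z e) m))
    sum< : load (e ∷ A) B (∁ X) + load (e ∷ A) B (∁ Y) < k + k
    sum< = begin-strict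
      load (e ∷ A) B (∁ X) + load (e ∷ A) B (∁ Y)  ≤⟨ +-mono-≤ ∁X≤ ∁Y≤ ⟩
      (mY + cX) + (1 + (mX + cY))                  ≡⟨ +-suc (mY + cX) (mX + cY) ⟩
      1 + ((mY + cX) + (mX + cY))                  ≡⟨ cong (1 +_) (cong₂ _+_ (+-comm mY cX) (+-comm mX cY)) ⟩
      1 + ((cX + mY) + (cY + mX))                  ≡⟨ cong (1 +_) (interchange cX mY cY mX) ⟩
      1 + ((cX + cY) + (mY + mX))                  ≡⟨ cong (1 +_) (+-comm (cX + cY) (mY + mX)) ⟩
      1 + ((mY + mX) + (cX + cY))                  ≡⟨ cong (1 +_) (cong (_+ (cX + cY)) (+-comm mY mX)) ⟩
      1 + ((mX + mY) + (cX + cY))                  ≡⟨ cong (1 +_) (interchange mX mY cX cY) ⟩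
      1 + (load A B X + load A B Y)                <⟨ s≤s (n<1+n _) ⟩
      2 + (load A B X + load A B Y)                ≡⟨ cong suc (+-suc (load A B X) (load A B Y)) ⟨
      (1 + load A B X) + (1 + load A B Y)          ≡⟨ cong₂ _+_ (1+load (meets⁺ x₀∈e (e⊆X x₀∈e))) (1+load mYe) ⟨
      load (e ∷ A) B X + load (e ∷ A) B Y          ≡⟨ cong₂ _+_ loadX loadY ⟩
      k + k                                        ∎
      where
      mX = count (meets? X) A
      mY = count (meets? Y) A
      cX = cut B X
      cY = cut B Y

  ¬tight : ∀ {Y} → Tight k (e ∷ A) B Y → Meets Y e → ¬ Meets Y f
  ¬tight {Y} tY mYe mYf with meets⁻ Y e mYe | meets⁻ Y f mYf
  ... | y , y∈e , y∈Y | y′ , y′∈f , y′∈Y =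
    -- The vertex `y′` of `f` lies in `Y` but not in `X`, so the tight set `X ∪ Y` is strictly
    -- larger than `X` and still contains `e`.
    maxX (X ∪ Y) (p⊆p∪q Y , y′ , q⊆p∪q X Y y′∈Y , λ y′∈X → f∌X (meets⁺ y′∈f y′∈X))
      (proj₂ (tight-∩-∪ (e ∷ A) B conn tX tY (meets⁺ y∈Y (e⊆X y∈e)) (tight∪⊂⊤ tY mYe)) , p⊆p∪q Y ∘ e⊆X)

  merge : SplitConnected k (e ∪ f ∷ A′) B
  merge Y neY Y⊂⊤ rewrite load-∷ˡ (e ∪ f) A′ B Y with meets? Y e ×-dec meets? Y f
  ... | no ¬both = begin
    k                                                  ≤⟨ conn Y neY Y⊂⊤ ⟩
    load (e ∷ A) B Y                                   ≡⟨ load≡ Y ⟩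
    ι (meets? Y e) + (ι (meets? Y f) + load A′ B Y)    ≡⟨ +-assoc (ι (meets? Y e)) _ _ ⟨
    ι (meets? Y e) + ι (meets? Y f) + load A′ B Y      ≤⟨ +-monoˡ-≤ (load A′ B Y) (ι-∪ Y ¬both) ⟩
    ι (meets? Y (e ∪ f)) + load A′ B Y                 ∎
  -- A set meeting both `e` and `f` loses exactly one unit in the merge, and by `¬tight` its load
  -- exceeded `k`.
  ... | yes (mYe , mYf) = ≤-pred (begin-strict
    k                                                  <⟨ ≤∧≢⇒< (conn Y neY Y⊂⊤) (λ k≡load → ¬tight (neY , Y⊂⊤ , sym k≡load) mYe mYf) ⟩
    load (e ∷ A) B Y                                   ≡⟨ load≡ Y ⟩
    ι (meets? Y e) + (ι (meets? Y f) + load A′ B Y)    ≡⟨ cong₂ (λ i j → i + (j + load A′ B Y)) (ι-yes (meets? Y e) mYe) (ι-yes (meets? Y f) mYf) ⟩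
    2 + load A′ B Y                                    ≡⟨ cong (λ i → 1 + (i + load A′ B Y)) (ι-yes (meets? Y (e ∪ f)) mY∪) ⟨
    1 + (ι (meets? Y (e ∪ f)) + load A′ B Y)           ∎)
    where
    mY∪ : Meets Y (e ∪ f)
    mY∪ = let y , y∈e , y∈Y = meets⁻ Y e mYe in meets⁺ (p⊆p∪q f y∈e) y∈Y

-- Groups of parts and the complete splitting off of a vertex.

∈⋃⁺ : ∀ {x} (es : List (Subset n)) → Any (x ∈_) es → x ∈ ⋃ es
∈⋃⁺ (e ∷ es) (here x∈e)   = p⊆p∪q (⋃ es) x∈e
∈⋃⁺ (e ∷ es) (there x∈es) = q⊆p∪q e (⋃ es) (∈⋃⁺ es x∈es)

∈⋃⁻ : ∀ {x} (es : List (Subset n)) → x ∈ ⋃ es → Any (x ∈_) es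
∈⋃⁻ []       x∈⊥ = contradiction x∈⊥ ∉⊥
∈⋃⁻ (e ∷ es) x∈  = [ here , there ∘ ∈⋃⁻ es ]′ (x∈p∪q⁻ e (⋃ es) x∈)

⋃-++ : ∀ (ds es : List (Subset n)) → ⋃ (ds ++ es) ≡ ⋃ ds ∪ ⋃ es
⋃-++ []       es = sym (∪-identityˡ (⋃ es))
⋃-++ (d ∷ ds) es = trans (cong (d ∪_) (⋃-++ ds es)) (sym (∪-assoc d (⋃ ds) (⋃ es)))

concat-↭ : {xss yss : List (List A)} → xss ↭ yss → concat xss ↭ concat yss
concat-↭ ↭.refl           = ↭-refl
concat-↭ (↭.prep xs p)    = ++⁺ˡ xs (concat-↭ p)
concat-↭ (↭.swap xs ys p) = ↭-trans (shifts xs ys) (++⁺ˡ ys (++⁺ˡ xs (concat-↭ p)))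
concat-↭ (↭.trans p q)    = ↭-trans (concat-↭ p) (concat-↭ q)

Disjoint : Rel (Subset n) _
Disjoint d e = Empty (d ∩ e)

-- The parts of one hyperedge ⋃ ps that the pinching will split.
record IsGroup (ps : List (Subset n)) : Set where
  field
    nonempty  : 1 ≤ length ps
    nonempties : All Nonempty ps
    disjoint  : AllPairs Disjoint ps

open IsGroup

⋃-nonempty : ∀ {ps : List (Subset n)} → IsGroup ps → Nonempty (⋃ ps)
⋃-nonempty {ps = ps@(_ ∷ _)} g with nonempties g
... | (x , x∈p) ∷ _ = x , ∈⋃⁺ ps (here x∈p)

isGroup-++ : ∀ {ps qs : List (Subset n)} → IsGroup ps → IsGroup qs → Disjoint (⋃ ps) (⋃ qs) → IsGroup (ps ++ qs)
isGroup-++ {ps = ps} {qs} g h ps∩qs≡∅ = record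
  { nonempty   = ≤-trans (nonempty g) (≤-trans (m≤m+n _ _) (≤-reflexive (sym (length-++ ps))))
  ; nonempties = All.++⁺ (nonempties g) (nonempties h)
  ; disjoint   = AllPairs.++⁺ (disjoint g) (disjoint h)
      (All.tabulate λ {p} p∈ps → All.tabulate λ {q} q∈qs (x , x∈p∩q) →
        let x∈p , x∈q = x∈p∩q⁻ p q x∈p∩q
        in ps∩qs≡∅ (x , x∈p∩q⁺ (∈⋃⁺ ps (lose p∈ps x∈p) , ∈⋃⁺ qs (lose q∈qs x∈q))))
  }

-- Iterates `split-step` until no hyperedge is left at `s`. The groups remember which original parts
-- were merged, and the permutation shows that none is lost. The recursion is on the number `m` of
-- groups still at `s`, since the list with `g ++ h` is not a sublist of the input.
split-off : ∀ {k} m (Gs : List (List (Subset n))) B → length Gs ≡ m → All IsGroup Gs →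
  SplitConnected k (map ⋃ Gs) B →
  ∃ λ Fs → All IsGroup Fs × concat Fs ↭ concat Gs × SplitConnected k [] (map ⋃ Fs ++ B)
split-off zero    []       B _  _        conn = [] , [] , ↭-refl , conn
split-off (suc m) (g ∷ Gs) B eq (ig ∷ iGs) conn with split-step (⋃-nonempty ig) conn
... | inj₁ conn′ =
  let Fs , iFs , Fs↭Gs , connFs = split-off m Gs (⋃ g ∷ B) (suc-injective eq) iGs conn′
  in g ∷ Fs , ig ∷ iFs , ++⁺ˡ g Fs↭Gs ,
     λ X neX X⊂⊤ → subst (_ ≤_) (load-↭ {A = []} ↭-refl (shift (⋃ g) (map ⋃ Fs) B) X) (connFs X neX X⊂⊤)
... | inj₂ (f , A′ , A↭ , g∩f≡∅ , conn′) with ↭-map-inv ⋃ A↭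
-- The partner `f` is itself the union of a group `h`, so merging hyperedges amounts to
-- concatenating groups.
...   | h ∷ Hs , refl , Gs↭ with All-resp-↭ Gs↭ iGs
...     | ih ∷ iHs =
  let Fs , iFs , Fs↭ , connFs = split-off m ((g ++ h) ∷ Hs) B
        (trans (sym (↭-length Gs↭)) (suc-injective eq)) (isGroup-++ ig ih g∩f≡∅ ∷ iHs)
        (subst (λ e → SplitConnected _ (e ∷ A′) B) (sym (⋃-++ g h)) conn′)
  in Fs , iFs ,
     ↭-trans Fs↭ (↭-trans (↭-reflexive (++-assoc g h (concat Hs))) (++⁺ˡ g (↭-sym (concat-↭ Gs↭)))) ,
     connFs

-- From groups to a pinching.

tabulate-∘-lookup : {B : Set b} (h : A → B) (xs : List A) → tabulate (h ∘ lookup xs) ≡ map h xs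
tabulate-∘-lookup h xs = trans (sym (map-tabulate (lookup xs) h)) (cong (map h) (tabulate-lookup xs))

-- Identifies the new hyperedges of `pinched`, a nested tabulation, with the flattened list of all
-- parts.
concat-tabulate-lookup : {B : Set b} (h : A → B) (xss : List (List A)) →
  concat (tabulate λ i → tabulate λ j → h (lookup (lookup xss i) j)) ≡ map h (concat xss)
concat-tabulate-lookup h []         = refl
concat-tabulate-lookup h (xs ∷ xss) =
  trans (cong₂ _++_ (tabulate-∘-lookup h xs) (concat-tabulate-lookup h xss)) (sym (map-++ h xs (concat xss)))

length-concat-tabulate : ∀ {m} (xs : Fin m → List A) →
  length (concat (tabulate xs)) ≡ sum (tabulate (length ∘ xs))
length-concat-tabulate {m = zero}  xs = refl
length-concat-tabulate {m = suc m} xs =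
  trans (length-++ (xs zero)) (cong (length (xs zero) +_) (length-concat-tabulate (xs ∘ suc)))

All-lookupAt : {P : Pred A p} {xs : List A} → All P xs → ∀ i → P (lookup xs i)
All-lookupAt {xs = xs} pxs i = All.lookup pxs (∈-lookup {xs = xs} i)

disjoint-lookup : ∀ {ps : List (Subset n)} → AllPairs Disjoint ps →
  ∀ {i j} → i ≢ j → Disjoint (lookup ps i) (lookup ps j)
disjoint-lookup (_  ∷ _) {zero}  {zero}  i≢j = contradiction refl i≢j
disjoint-lookup (rs ∷ _) {zero}  {suc j} _   = All-lookupAt rs j
disjoint-lookup {ps = p ∷ ps} (rs ∷ _) {suc i} {zero} _ =
  subst Empty (∩-comm p (lookup ps i)) (All-lookupAt rs i)
disjoint-lookup (_ ∷ ds) {suc i} {suc j} i≢j = disjoint-lookup ds (i≢j ∘ cong suc)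

isGroup⇒isPartition : ∀ {ps : List (Subset n)} → IsGroup ps → IsPartition (⋃ ps) (lookup ps)
isGroup⇒isPartition {ps = ps} g = record
  { nonempty = All-lookupAt (nonempties g)
  ; disjoint = disjoint-lookup (disjoint g)
  ; covers   = cong ⋃ (tabulate-lookup ps)
  }

-- Every group contributes at least one part. This yields the bound `p ≤ k` for the pinching.
length≤length-concat : ∀ {Fs : List (List (Subset n))} → All IsGroup Fs → length Fs ≤ length (concat Fs)
length≤length-concat []                   = z≤n
length≤length-concat {Fs = F ∷ _} (g ∷ gs) =
  ≤-trans (+-mono-≤ (nonempty g) (length≤length-concat gs)) (≤-reflexive (sym (length-++ F)))

1≤length-concat⁻ : ∀ {xss : List (List A)} → 1 ≤ length (concat xss) → 1 ≤ length xss
1≤length-concat⁻ {xss = _ ∷ _} _ = s≤s z≤n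

-- Each group gives one hyperedge to pinch, and its members are the parts; hence `p` is the number
-- of groups and `k` the number of parts overall.
groups⇒pinching : ∀ {n k} {Fs : List (List (Subset (suc n)))} (B : List (Subset (suc n))) → All IsGroup Fs →
  length (concat Fs) ≡ k → Pinching k (length Fs) (hypergraph (map ⋃ Fs ++ B))
groups⇒pinching {Fs = Fs} B gs ∣Fs∣≡k = record
  { e           = ⋃ ∘ lookup Fs
  ; rest        = B
  ; split       = ↭-reflexive (cong (_++ B) (sym (tabulate-∘-lookup ⋃ Fs)))
  ; t           = length ∘ lookup Fs
  ; t-positive  = nonempty ∘ All-lookupAt gs
  ; t-sum       = trans (sym (length-concat-tabulate (lookup Fs)))
                    (trans (cong (length ∘ concat) (tabulate-lookup Fs)) ∣Fs∣≡k)
  ; f           = lookup ∘ lookup Fs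
  ; f-partition = isGroup⇒isPartition ∘ All-lookupAt gs
  }

-- Relabelling vertices and reordering hyperedges.

image-id : ∀ (X : Subset n) → image idₚ X ≡ X
image-id = Vec.tabulate∘lookup

image-flip : ∀ (π : Permutation′ n) X → image (flip π) (image π X) ≡ X
image-flip π X = trans
  (Vec.tabulate-cong λ v → trans (Vec.lookup∘tabulate _ (π ⟨$⟩ʳ v)) (cong (Vec.lookup X) (inverseˡ π)))
  (Vec.tabulate∘lookup X)

∈-image⁻ : ∀ (π : Permutation′ n) {v} {X : Subset n} → v ∈ image π X → π ⟨$⟩ˡ v ∈ X
∈-image⁻ π {v} {X} v∈ = Vec.lookup⇒[]= (π ⟨$⟩ˡ v) X
  (trans (sym (Vec.lookup∘tabulate (λ u → Vec.lookup X (π ⟨$⟩ˡ u)) v)) (Vec.[]=⇒lookup v∈))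

∈-image⁺ : ∀ (π : Permutation′ n) {v} {X : Subset n} → v ∈ X → π ⟨$⟩ʳ v ∈ image π X
∈-image⁺ π {v} {X} v∈X = Vec.lookup⇒[]= (π ⟨$⟩ʳ v) (image π X)
  (trans (Vec.lookup∘tabulate (λ u → Vec.lookup X (π ⟨$⟩ˡ u)) (π ⟨$⟩ʳ v))
    (trans (cong (Vec.lookup X) (inverseˡ π)) (Vec.[]=⇒lookup v∈X)))

∈-image⁻′ : ∀ (π : Permutation′ n) {v} {X : Subset n} → π ⟨$⟩ʳ v ∈ image π X → v ∈ X
∈-image⁻′ π {X = X} πv∈ = subst (_∈ X) (inverseˡ π) (∈-image⁻ π πv∈)

crosses-image : ∀ (π : Permutation′ n) {X e : Subset n} → Crosses X e → Crosses (image π X) (image π e)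
crosses-image π {X} {e} c =
  let (x , x∈e , x∈X) , (y , y∈e , y∉X) = crosses⁻ X e c
  in crosses⁺ (∈-image⁺ π x∈e) (∈-image⁺ π x∈X) (∈-image⁺ π y∈e) (y∉X ∘ ∈-image⁻′ π)

crosses-image⁻ : ∀ (π : Permutation′ n) {X e : Subset n} → Crosses (image π X) (image π e) → Crosses X e
crosses-image⁻ π {X} {e} c = cong-Crosses (crosses-image (flip π) c)
  where
  cong-Crosses : Crosses (image (flip π) (image π X)) (image (flip π) (image π e)) → Crosses X e
  cong-Crosses rewrite image-flip π X | image-flip π e = id

cut-image : ∀ (π : Permutation′ n) es X → cut (map (image π) es) (image π X) ≡ cut es X
cut-image π es X = trans (count-map (crosses? (image π X)) (image π) es)
  (count-cong (crosses? (image π X) ∘ image π) (crosses? X)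
    (λ _ → crosses-image⁻ π) (λ _ → crosses-image π) es)

cut-↭ : ∀ {es fs : List (Subset n)} → es ↭ fs → ∀ X → cut es X ≡ cut fs X
cut-↭ es↭fs X = count-↭ (crosses? X) es↭fs

connected-≅ : ∀ {k} {G H : Hypergraph n} → G ≅ H → k HyperedgeConnected G → k HyperedgeConnected H
connected-≅ {k = k} {G} {H} (π , G↭H) conn X (x , x∈X) (_ , y , _ , y∉X) = begin
  k                                         ≤⟨ conn X′ (_ , ∈-image⁺ (flip π) x∈X) (∉⇒⊂⊤ (y∉X ∘ ∈-image⁻′ (flip π))) ⟩
  cut (edges G) X′                          ≡⟨ cut-image π (edges G) X′ ⟨
  cut (map (image π) (edges G)) (image π X′) ≡⟨ cut-↭ G↭H (image π X′) ⟩
  cut (edges H) (image π X′)                ≡⟨ cong (cut (edges H)) (image-flip (flip π) X) ⟩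
  cut (edges H) X                           ∎
  where
  open ≤-Reasoning
  X′ = image (flip π) X

≅-relabel : ∀ (π : Permutation′ (suc n)) es → hypergraph (map (image π) es) ≅ hypergraph es
≅-relabel π es = flip π , ↭-reflexive (trans (sym (map-∘ es)) (trans (map-cong (image-flip π) es) (map-id es)))

-- The identity permutation in `relabel` leaves the vertices fixed and still permits any reordering
-- of the list.
obtainable-↭ : ∀ {k n} {es fs : List (Subset (suc n))} →
  Obtainable k (hypergraph es) → es ↭ fs → Obtainable k (hypergraph fs)
obtainable-↭ {es = es} o es↭fs =
  relabel o (idₚ , ↭-trans (↭-reflexive (trans (map-cong image-id es) (map-id es))) es↭fs)

-- Cuts of a hypergraph in which `zero` plays the role of `s`.

crosses-in : ∀ {X a : Subset n} → Meets X a → Crosses (outside ∷ X) (inside ∷ a)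
crosses-in {X = X} {a} m = let x , x∈a , x∈X = meets⁻ X a m
  in crosses⁺ {y = zero} (Vec.there x∈a) (Vec.there x∈X) Vec.here λ ()

crosses-in⁻ : ∀ {X a : Subset n} → Crosses (outside ∷ X) (inside ∷ a) → Meets X a
crosses-in⁻ {X = X} {a} c with crosses⁻ (outside ∷ X) (inside ∷ a) c
... | (suc x , Vec.there x∈a , Vec.there x∈X) , _ = meets⁺ x∈a x∈X

crosses-out : ∀ {X b : Subset n} → Crosses X b → Crosses (outside ∷ X) (outside ∷ b)
crosses-out {X = X} {b} c = let (x , x∈b , x∈X) , (y , y∈b , y∉X) = crosses⁻ X b c
  in crosses⁺ {X = outside ∷ X} {e = outside ∷ b} (Vec.there x∈b) (Vec.there x∈X) (Vec.there y∈b) (y∉X ∘ drop-there)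

crosses-out⁻ : ∀ {X b : Subset n} → Crosses (outside ∷ X) (outside ∷ b) → Crosses X b
crosses-out⁻ {X = X} {b} c with crosses⁻ (outside ∷ X) (outside ∷ b) c
... | (suc x , Vec.there x∈b , Vec.there x∈X) , (suc y , Vec.there y∈b , y∉X) =
  crosses⁺ x∈b x∈X y∈b (y∉X ∘ Vec.there)

cut-outside : ∀ (B : List (Subset n)) X → cut (map (outside ∷_) B) (outside ∷ X) ≡ cut B X
cut-outside B X = trans (count-map (crosses? (outside ∷ X)) (outside ∷_) B)
  (count-cong _ (crosses? X) (λ _ → crosses-out⁻) (λ _ → crosses-out) B)

cut-inside : ∀ (A : List (Subset n)) X → cut (map (inside ∷_) A) (outside ∷ X) ≡ count (meets? X) A
cut-inside A X = trans (count-map (crosses? (outside ∷ X)) (inside ∷_) A)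
  (count-cong _ (meets? X) (λ _ → crosses-in⁻) (λ _ → crosses-in) A)

-- The vertex `zero` lies outside `outside ∷ X`, so `inside ∷ a` crosses this set as soon as `a`
-- meets `X`. This ties `load` to genuine cuts.
cut-star : ∀ (A B : List (Subset n)) X →
  cut (map (inside ∷_) A ++ map (outside ∷_) B) (outside ∷ X) ≡ load A B X
cut-star A B X = trans (count-++ (crosses? (outside ∷ X)) (map (inside ∷_) A) _)
  (cong₂ _+_ (cut-inside A X) (cut-outside B X))

cut-centre : ∀ {A : List (Subset n)} (B : List (Subset n)) → All Nonempty A →
  cut (map (inside ∷_) A ++ map (outside ∷_) B) ⁅ zero ⁆ ≡ length A
cut-centre {A = A} B neA = begin
  cut (map (inside ∷_) A ++ map (outside ∷_) B) ⁅ zero ⁆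
    ≡⟨ count-++ c? (map (inside ∷_) A) _ ⟩
  count c? (map (inside ∷_) A) + count c? (map (outside ∷_) B)
    ≡⟨ cong₂ (λ fs gs → length fs + length gs)
         (filter-all c? (All.map⁺ (All.map in-crosses neA)))
         (filter-none c? (All.map⁺ (All.universal out-misses B))) ⟩
  length (map (inside ∷_) A) + 0
    ≡⟨ trans (+-identityʳ _) (length-map (inside ∷_) A) ⟩
  length A ∎
  where
  open ≡-Reasoning
  c? = crosses? ⁅ zero ⁆
  in-crosses : ∀ {a} → Nonempty a → Crosses ⁅ zero ⁆ (inside ∷ a)
  in-crosses (x , x∈a) = crosses⁺ {x = zero} Vec.here Vec.here (Vec.there x∈a) (∉⊥ ∘ drop-there)
  out-misses : ∀ b → ¬ Crosses ⁅ zero ⁆ (outside ∷ b)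
  out-misses b c with crosses⁻ ⁅ zero ⁆ (outside ∷ b) c
  ... | (suc x , _ , Vec.there x∈⊥) , _ = ∉⊥ x∈⊥

-- A hyperedge crossing some set has two distinct vertices, so it is not `⁅ zero ⁆` and stays
-- non-empty when `zero` is removed. The members of `A` can therefore serve as parts of a partition.
star-decomposition : ∀ (es : List (Subset (suc n))) → All (λ e → ∃ λ Y → Crosses Y e) es →
  ∃₂ λ A B → All Nonempty A × es ↭ map (inside ∷_) A ++ map (outside ∷_) B
star-decomposition []                  []       = [] , [] , [] , ↭-refl
star-decomposition ((inside ∷ a) ∷ es) ((Y , c) ∷ cs) =
  let A , B , neA , es↭ = star-decomposition es cs
  in a ∷ A , B , nonempty-a ∷ neA , ↭.prep (inside ∷ a) es↭
  where
  nonempty-a : Nonempty a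
  nonempty-a with crosses⁻ Y (inside ∷ a) c
  ... | (suc x , Vec.there x∈a , _) , _                 = x , x∈a
  ... | (zero , _) , (suc y , Vec.there y∈a , _)        = y , y∈a
  ... | (zero , _ , zero∈Y) , (zero , _ , zero∉Y)       = contradiction zero∈Y zero∉Y
star-decomposition ((outside ∷ b) ∷ es) (_ ∷ cs) =
  let A , B , neA , es↭ = star-decomposition es cs
  in A , b ∷ B , neA ,
     ↭-trans (↭.prep (outside ∷ b) es↭) (↭-sym (shift (outside ∷ b) (map (inside ∷_) A) (map (outside ∷_) B)))

-- Connected hypergraphs are obtainable.

-- Descent through tight sets: a hyperedge inside `X` crosses some tight set, and uncrossing that
-- set with `X` gives a smaller tight set.
tight-vertex : ∀ {k} {es : List (Subset n)} → SplitConnected k [] es →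
  All (λ e → ∃ λ Y → Tight k [] es Y × Crosses Y e) es → ∃ (Tight k [] es) →
  ∃ λ v → Tight k [] es ⁅ v ⁆
tight-vertex {n = n} {k} {es} conn tights (X₀ , tX₀) = go X₀ tX₀ (⊂-wellFounded X₀)
  where
  go : ∀ X → Tight k [] es X → Acc _⊂_ X → ∃ λ v → Tight k [] es ⁅ v ⁆
  go X tX@((v , v∈X) , X⊂⊤@(_ , w , _ , w∉X) , cutX) (acc rec) with any? (_⊆? X) es
  ... | no ∄e = v , (v , x∈⁅x⁆ v) , v⊂⊤ , ≤-antisym (≤-trans cut≤ (≤-reflexive cutX)) (conn ⁅ v ⁆ (v , x∈⁅x⁆ v) v⊂⊤)
    where
    v⊂⊤ : ⁅ v ⁆ ⊂ ⊤
    v⊂⊤ = ∉⇒⊂⊤ λ w∈⁅v⁆ → w∉X (subst (_∈ X) (sym (x∈⁅y⁆⇒x≡y v w∈⁅v⁆)) v∈X)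
    cut≤ : cut es ⁅ v ⁆ ≤ cut es X
    cut≤ = count-mono (crosses? ⁅ v ⁆) (crosses? X) (All.map leaves (All.¬Any⇒All¬ es ∄e))
      where
      leaves : ∀ {e} → ¬ e ⊆ X → Crosses ⁅ v ⁆ e → Crosses X e
      leaves {e} e⊈X c with crosses⁻ ⁅ v ⁆ e c
      ... | (x , x∈e , x∈⁅v⁆) , _ =
        meets⁺ x∈e (subst (_∈ X) (sym (x∈⁅y⁆⇒x≡y v x∈⁅v⁆)) v∈X) ,
        decidable-stable (nonempty? (e ─ X)) (λ e─X≡∅ → e⊈X (Empty─⇒⊆ e─X≡∅))
  ... | yes ∃e with find ∃e
  ...   | e , e∈es , e⊆X with All.lookup tights e∈es
  ...     | Y , tY , c = shrink (w ∈? Y)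
    where
    descend : ∀ {Z} → Tight k [] es Z → Crosses Z e → w ∉ Z → ∃ λ v → Tight k [] es ⁅ v ⁆
    descend {Z} tZ c w∉Z with crosses⁻ Z e c
    -- As `e` lies in `X` and crosses `Z`, it gives a common vertex `x`, needed for uncrossing, and
    -- a vertex `y` of `X` outside `Z`, which makes `X ∩ Z` strictly smaller.
    ... | (x , x∈e , x∈Z) , (y , y∈e , y∉Z) = go (X ∩ Z)
      (proj₁ (tight-∩-∪ [] es conn tX tZ (meets⁺ x∈Z (e⊆X x∈e)) (∉⇒⊂⊤ ([ w∉X , w∉Z ]′ ∘ x∈p∪q⁻ X Z))))
      (rec (p∩q⊆p X Z , y , e⊆X y∈e , y∉Z ∘ p∩q⊆q X Z))
    tight-∁ : Tight k [] es Y → Tight k [] es (∁ Y)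
    tight-∁ ((y , y∈Y) , (_ , z , _ , z∉Y) , cutY) =
      (z , x∉p⇒x∈∁p z∉Y) , ∉⇒⊂⊤ (x∈p⇒x∉∁p y∈Y) , trans (cut-∁ es Y) cutY
    -- Both `Y` and `∁ Y` are tight and crossed by `e`. The one avoiding `w` is chosen, so that its
    -- union with `X` is a proper subset.
    shrink : Dec (w ∈ Y) → ∃ λ v → Tight k [] es ⁅ v ⁆
    shrink (no w∉Y)  = descend tY c w∉Y
    shrink (yes w∈Y) = descend (tight-∁ tY) (crosses-∁ c) (x∈p⇒x∉∁p w∈Y)

-- Only sets crossed by `e` lose a unit, and none of them is tight, so their cuts exceed `k`
-- beforehand.
remove-edge : ∀ {k e} {es rest : List (Subset n)} → SplitConnected k [] es → es ↭ e ∷ rest →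
  ¬ (∃ λ Y → Tight k [] es Y × Crosses Y e) → SplitConnected k [] rest
remove-edge {k = k} {e} {es} {rest} conn es↭ ∄Y X neX X⊂⊤ = bound (crosses? X e)
  where
  open ≤-Reasoning
  cut≡ : cut es X ≡ ι (crosses? X e) + cut rest X
  cut≡ = trans (cut-↭ es↭ X) (count-∷ (crosses? X) e rest)
  bound : Dec (Crosses X e) → k ≤ cut rest X
  bound (yes c) = ≤-pred (begin-strict
    k                               <⟨ ≤∧≢⇒< (conn X neX X⊂⊤) (λ k≡cut → ∄Y (X , (neX , X⊂⊤ , sym k≡cut) , c)) ⟩
    cut es X                        ≡⟨ cut≡ ⟩
    ι (crosses? X e) + cut rest X   ≤⟨ +-monoˡ-≤ (cut rest X) (ι≤1 (crosses? X e)) ⟩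
    1 + cut rest X                  ∎)
  bound (no ¬c) = begin
    k                               ≤⟨ conn X neX X⊂⊤ ⟩
    cut es X                        ≡⟨ cut≡ ⟩
    ι (crosses? X e) + cut rest X   ≡⟨ cong (_+ cut rest X) (ι-no (crosses? X e) ¬c) ⟩
    cut rest X                      ∎

-- Splitting off all hyperedges at `zero` yields a connected hypergraph with one vertex fewer, which
-- `obtain` handles; pinching its groups restores `es`. The degree `k` of `zero` is the number of
-- parts that the pinching must create.
pinch-vertex : ∀ {k n} {es : List (Subset (suc (suc n)))} → 1 ≤ k → SplitConnected k [] es →
  All (λ e → ∃ λ Y → Crosses Y e) es → cut es ⁅ zero ⁆ ≡ k →
  (∀ fs → SplitConnected k [] fs → Obtainable k (hypergraph {suc n} fs)) → Obtainable k (hypergraph es)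
pinch-vertex {k} {n} {es} 1≤k conn crossed degree≡k obtain with star-decomposition es crossed
... | A , B , neA , es↭ = obtainable-↭ (pinch (obtain _ connFs) 1≤∣Fs∣ ∣Fs∣≤k (groups⇒pinching B iFs ∣concat∣≡k))
  (begin
    map (outside ∷_) B ++ concat (tabulate λ i → tabulate λ j → inside ∷ lookup (lookup Fs i) j)
      ≡⟨ cong (map (outside ∷_) B ++_) (concat-tabulate-lookup (inside ∷_) Fs) ⟩
    map (outside ∷_) B ++ map (inside ∷_) (concat Fs)
      ↭⟨ ++-comm (map (outside ∷_) B) _ ⟩
    map (inside ∷_) (concat Fs) ++ map (outside ∷_) B
      ↭⟨ ++⁺ʳ (map (outside ∷_) B) (map⁺ (inside ∷_) Fs↭A) ⟩
    map (inside ∷_) A ++ map (outside ∷_) B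
      ↭⟨ es↭ ⟨
    es ∎)
  where
  open PermutationReasoning
  ∣A∣≡k : length A ≡ k
  ∣A∣≡k = trans (sym (trans (cut-↭ es↭ ⁅ zero ⁆) (cut-centre B neA))) degree≡k
  ⋃[_] : (a : Subset (suc n)) → ⋃ [ a ] ≡ a
  ⋃[ a ] = ∪-identityʳ a
  split : SplitConnected k A B
  split X (x , x∈X) (_ , y , _ , y∉X) =
    subst (k ≤_) (trans (cut-↭ es↭ (outside ∷ X)) (cut-star A B X))
      (conn (outside ∷ X) (suc x , Vec.there x∈X) (∉⇒⊂⊤ {x = suc y} (y∉X ∘ drop-there)))
  singletons≡ : map ⋃ (map [_] A) ≡ A
  singletons≡ = trans (sym (map-∘ A)) (trans (map-cong ⋃[_] A) (map-id A))
  isGroup-[_] : ∀ {a} → Nonempty a → IsGroup [ a ]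
  isGroup-[ nea ] = record { nonempty = s≤s z≤n ; nonempties = nea ∷ [] ; disjoint = [] ∷ [] }
  groups : ∃ λ Fs → All IsGroup Fs × concat Fs ↭ concat (map [_] A) × SplitConnected k [] (map ⋃ Fs ++ B)
  -- Initially each hyperedge at `zero` forms a group of its own.
  groups = split-off _ (map [_] A) B refl (All.map⁺ (All.map isGroup-[_] neA))
    (subst (λ A → SplitConnected k A B) (sym singletons≡) split)
  Fs = proj₁ groups
  iFs : All IsGroup Fs
  iFs = proj₁ (proj₂ groups)
  Fs↭A : concat Fs ↭ A
  Fs↭A = ↭-trans (proj₁ (proj₂ (proj₂ groups))) (↭-reflexive (concat-map-[_] A))
  connFs = proj₂ (proj₂ (proj₂ groups))
  ∣concat∣≡k : length (concat Fs) ≡ k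
  ∣concat∣≡k = trans (↭-length Fs↭A) ∣A∣≡k
  ∣Fs∣≤k : length Fs ≤ k
  ∣Fs∣≤k = ≤-trans (length≤length-concat iFs) (≤-reflexive ∣concat∣≡k)
  1≤∣Fs∣ : 1 ≤ length Fs
  1≤∣Fs∣ = 1≤length-concat⁻ {xss = Fs} (≤-trans 1≤k (≤-reflexive (sym ∣concat∣≡k)))

-- Without hyperedges, `⁅ zero ⁆` would have an empty cut, contrary to `1 ≤ k`; it is a proper
-- subset because there are at least two vertices.
tight-exists : ∀ {k} {es : List (Subset (suc (suc n)))} → 1 ≤ k → SplitConnected k [] es →
  All (λ e → ∃ λ Y → Tight k [] es Y × Crosses Y e) es → ∃ (Tight k [] es)
tight-exists {es = []}    1≤k conn _ =
  contradiction (conn ⁅ zero ⁆ (zero , Vec.here) (∉⇒⊂⊤ {x = suc zero} (∉⊥ ∘ drop-there))) (<⇒≱ 1≤k)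
tight-exists {es = _ ∷ _} _ _ ((Y , tY , _) ∷ _) = Y , tY

crossed-by-tight? : ∀ k (es : List (Subset n)) → Decidable (λ e → ∃ λ Y → Tight k [] es Y × Crosses Y e)
crossed-by-tight? k es e = anySubset? (λ Y → tight? k [] es Y ×-dec crosses? Y e)

edge-removable-or-all-tight : ∀ {k} {es : List (Subset n)} → SplitConnected k [] es →
  (∃₂ λ e rest → es ↭ e ∷ rest × SplitConnected k [] rest) ⊎
  All (λ e → ∃ λ Y → Tight k [] es Y × Crosses Y e) es
edge-removable-or-all-tight {k = k} {es} conn with All.all? (crossed-by-tight? k es) es
... | yes tights = inj₂ tights
... | no ¬tights with find (All.¬All⇒Any¬ (crossed-by-tight? k es) es ¬tights)
...   | e , e∈es , ∄Y =
  let rest , es↭ = ∈⇒↭∷ e∈es in inj₁ (e , rest , es↭ , remove-edge conn es↭ ∄Y)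

-- The tight vertex may be anywhere, whereas `pinched` always puts its new vertex at `zero`; a
-- transposition moves it there and `relabel` moves it back.
pinch-some-vertex : ∀ {k n} {es : List (Subset (suc (suc n)))} → 1 ≤ k → SplitConnected k [] es →
  All (λ e → ∃ λ Y → Tight k [] es Y × Crosses Y e) es →
  (∀ fs → SplitConnected k [] fs → Obtainable k (hypergraph {suc n} fs)) → Obtainable k (hypergraph es)
pinch-some-vertex {es = es} 1≤k conn tights obtain with tight-vertex conn tights (tight-exists 1≤k conn tights)
... | v , _ , _ , degree≡k = relabel
  (pinch-vertex 1≤k (connected-≅ {G = hypergraph es} (π , ↭-refl) conn)
    (All.map⁺ (All.map (λ (Y , _ , c) → image π Y , crosses-image π c) tights))
    (trans (cong (cut (map (image π) es)) (sym image-⁅v⁆)) (trans (cut-image π es ⁅ v ⁆) degree≡k))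
    obtain)
  (≅-relabel π es)
  where
  π = transpose v zero
  image-⁅v⁆ : image π ⁅ v ⁆ ≡ ⁅ zero ⁆
  image-⁅v⁆ = ⊆-antisym
    (λ {x} x∈ → subst (_∈ ⁅ zero ⁆) (trans (sym (πv≡0)) (trans (cong (π ⟨$⟩ʳ_) (sym (x∈⁅y⁆⇒x≡y v (∈-image⁻ π x∈)))) (inverseʳ π))) (x∈⁅x⁆ zero))
    (λ {x} x∈ → subst (_∈ image π ⁅ v ⁆) (trans πv≡0 (sym (x∈⁅y⁆⇒x≡y zero x∈))) (∈-image⁺ π (x∈⁅x⁆ v)))
    where
    πv≡0 : π ⟨$⟩ʳ v ≡ zero
    πv≡0 rewrite dec-true (v ≟ v) refl = refl

obtain-one-vertex : ∀ {k} (es : List (Subset 1)) → Obtainable k (hypergraph es)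
obtain-one-vertex []       = single
obtain-one-vertex (e ∷ es) = add (obtain-one-vertex es) e

-- Recursion on the number `m` of hyperedges: each removable one is deleted and later restored by
-- `add`. When none is removable, a pinching is undone and the vertex count drops.
obtain-step : ∀ {k n} → 1 ≤ k →
  (∀ fs → SplitConnected k [] fs → Obtainable k (hypergraph {suc n} fs)) →
  ∀ m es → length es ≡ m → SplitConnected k [] es → Obtainable k (hypergraph {suc (suc n)} es)
obtain-step 1≤k obtain m es eq conn with edge-removable-or-all-tight conn
... | inj₂ tights = pinch-some-vertex 1≤k conn tights obtain
obtain-step 1≤k obtain zero es eq conn | inj₁ (e , rest , es↭ , _) =
  contradiction (trans (sym (↭-length es↭)) eq) λ ()
obtain-step 1≤k obtain (suc m) es eq conn | inj₁ (e , rest , es↭ , conn′) = obtainable-↭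
  (add (obtain-step 1≤k obtain m rest (suc-injective (trans (sym (↭-length es↭)) eq)) conn′) e) (↭-sym es↭)

connected⇒obtainable : ∀ {k} → 1 ≤ k → ∀ n (es : List (Subset (suc n))) →
  SplitConnected k [] es → Obtainable k (hypergraph es)
connected⇒obtainable 1≤k zero    es conn = obtain-one-vertex es
connected⇒obtainable 1≤k (suc n) es conn = obtain-step 1≤k (connected⇒obtainable 1≤k n) _ es refl conn

-- Obtainable hypergraphs are connected.

connected-add : ∀ {k} (e : Subset n) {es} → SplitConnected k [] es → SplitConnected k [] (e ∷ es)
connected-add e {es} conn X neX X⊂⊤ = ≤-trans (conn X neX X⊂⊤)
  (≤-trans (m≤n+m (cut es X) (ι (crosses? X e))) (≤-reflexive (sym (count-∷ (crosses? X) e es))))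

-- A hyperedge crossing `X` has a vertex in `X`. The part holding that vertex, enlarged by the new
-- vertex, crosses `outside ∷ X`, since the new vertex is not in this set.
cut-refine : ∀ {p} (e : Fin p → Subset n) (t : Fin p → ℕ) (f : ∀ i → Fin (t i) → Subset n) →
  (∀ i → ⋃ (tabulate (f i)) ≡ e i) → ∀ X →
  cut (tabulate e) X ≤ cut (concat (tabulate λ i → tabulate λ j → inside ∷ f i j)) (outside ∷ X)
cut-refine {p = zero}  e t f covers X = z≤n
cut-refine {p = suc p} e t f covers X = begin
  cut (e zero ∷ tabulate (e ∘ suc)) X
    ≡⟨ count-∷ (crosses? X) (e zero) _ ⟩
  ι (crosses? X (e zero)) + cut (tabulate (e ∘ suc)) X
    ≤⟨ +-mono-≤ (ι≤ (crosses? X (e zero))) (cut-refine (e ∘ suc) (t ∘ suc) (f ∘ suc) (covers ∘ suc) X) ⟩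
  cut pieces (outside ∷ X) + cut (concat (tabulate λ i → tabulate λ j → inside ∷ f (suc i) j)) (outside ∷ X)
    ≡⟨ count-++ (crosses? (outside ∷ X)) pieces _ ⟨
  cut (pieces ++ concat (tabulate λ i → tabulate λ j → inside ∷ f (suc i) j)) (outside ∷ X) ∎
  where
  open ≤-Reasoning
  pieces = tabulate λ j → inside ∷ f zero j
  ι≤ : (c? : Dec (Crosses X (e zero))) → ι c? ≤ cut pieces (outside ∷ X)
  ι≤ (no _) = z≤n
  ι≤ (yes (m , _)) with meets⁻ X (e zero) m
  ... | x , x∈e , x∈X with Any.tabulate⁻ (∈⋃⁻ (tabulate (f zero)) (subst (x ∈_) (sym (covers zero)) x∈e))
  ...   | j , x∈fj = filter-some (crosses? (outside ∷ X)) (Any.tabulate⁺ j (crosses-in (meets⁺ x∈fj x∈X)))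

connected-pinched : ∀ {k p} {G : Hypergraph n} (P : Pinching k p G) →
  k HyperedgeConnected G → k HyperedgeConnected pinched P
connected-pinched {n = n} {k} {p} {G} P conn = connected
  where
  open Pinching P
  open ≤-Reasoning
  inside∷f : ∀ i → Fin (t i) → Subset (suc n)
  inside∷f i j = inside ∷ f i j
  parts : Fin p → List (Subset (suc n))
  parts i = tabulate (inside∷f i)
  pieces : List (Subset (suc n))
  pieces = concat (tabulate parts)
  cut≡ : ∀ X → cut (edges (pinched P)) (outside ∷ X) ≡ cut rest X + cut pieces (outside ∷ X)
  cut≡ X = trans (count-++ (crosses? (outside ∷ X)) (map (outside ∷_) rest) pieces)
    (cong (_+ cut pieces (outside ∷ X)) (cut-outside rest X))
  ∣pieces∣ : length pieces ≡ k
  ∣pieces∣ = trans (length-concat-tabulate parts)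
    (trans (cong sum (tabulate-cong {g = t} λ i → length-tabulate (inside∷f i))) t-sum)
  old : ∀ X → Nonempty X → Dec (Nonempty (∁ X)) → k ≤ cut (edges (pinched P)) (outside ∷ X)
  old X neX (yes (y , y∈∁X)) = begin
    k                                     ≤⟨ conn X neX (∉⇒⊂⊤ (x∈∁p⇒x∉p y∈∁X)) ⟩
    cut (edges G) X                       ≡⟨ cut-↭ split X ⟩
    cut (tabulate e ++ rest) X            ≡⟨ count-++ (crosses? X) (tabulate e) rest ⟩
    cut (tabulate e) X + cut rest X       ≤⟨ +-monoˡ-≤ (cut rest X)
                                               (cut-refine e t f (λ i → IsPartition.covers (f-partition i)) X) ⟩
    cut pieces (outside ∷ X) + cut rest X ≡⟨ +-comm (cut pieces (outside ∷ X)) (cut rest X) ⟩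
    cut rest X + cut pieces (outside ∷ X) ≡⟨ cut≡ X ⟨
    cut (edges (pinched P)) (outside ∷ X) ∎
  -- Here `X` consists of all old vertices, so the cut is that of `s`, and all `k` new hyperedges
  -- cross it because parts are non-empty.
  old X neX (no ∁X≡∅) = begin
    k                                     ≡⟨ ∣pieces∣ ⟨
    length pieces                         ≡⟨ cong length (filter-all (crosses? (outside ∷ X)) all-cross) ⟨
    cut pieces (outside ∷ X)              ≤⟨ m≤n+m _ (cut rest X) ⟩
    cut rest X + cut pieces (outside ∷ X) ≡⟨ cut≡ X ⟨
    cut (edges (pinched P)) (outside ∷ X) ∎
    where
    all-cross : All (Crosses (outside ∷ X)) pieces
    all-cross = All.concat⁺ (All.tabulate⁺ λ i → All.tabulate⁺ λ j →
      let x , x∈f = IsPartition.nonempty (f-partition i) j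
      in crosses-in (meets⁺ x∈f (x∉∁p⇒x∈p (λ x∈∁X → ∁X≡∅ (x , x∈∁X)))))
  connected : k HyperedgeConnected pinched P
  connected (outside ∷ X) (suc x , Vec.there x∈X) _ = old X (x , x∈X) (nonempty? (∁ X))
  connected (inside ∷ X) _ (_ , zero , _ , zero∉X) = contradiction Vec.here zero∉X
  -- A set containing `s` has the same cut as its complement, which consists of old vertices only.
  connected (inside ∷ X) _ (_ , suc y , _ , y∉X) = begin
    k                                             ≤⟨ old (∁ X) (y , x∉p⇒x∈∁p (y∉X ∘ Vec.there)) (nonempty? (∁ (∁ X))) ⟩
    cut (edges (pinched P)) (∁ (inside ∷ X))      ≡⟨ cut-∁ (edges (pinched P)) (inside ∷ X) ⟩
    cut (edges (pinched P)) (inside ∷ X)          ∎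

obtainable⇒connected : ∀ {k} {G : Hypergraph n} → Obtainable k G → k HyperedgeConnected G
obtainable⇒connected single X (zero , zero∈X) (_ , zero , _ , zero∉X) = contradiction zero∈X zero∉X
obtainable⇒connected (add o e)        = connected-add e (obtainable⇒connected o)
obtainable⇒connected (pinch o _ _ P)  = connected-pinched P (obtainable⇒connected o)
obtainable⇒connected (relabel {G = G} {H} o G≅H) = connected-≅ {G = G} {H} G≅H (obtainable⇒connected o)

theorem1p2 : ∀ (k : ℕ) .{{_ : NonZero k}} {n : ℕ} (G : Hypergraph n) →
    (k HyperedgeConnected G) ⇔ Obtainable k G
theorem1p2 k {zero}  (hypergraph {{0≢0}} es) = contradiction refl (≢-nonZero⁻¹ 0 {{0≢0}})
-- With no hyperedges at `s`, `SplitConnected k []` unfolds to `k HyperedgeConnected_`, so no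
-- conversion is required.
theorem1p2 k {suc n} (hypergraph es) = mk⇔ (connected⇒obtainable (>-nonZero⁻¹ k) n es) obtainable⇒connected
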